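{- For every $f\ge0$, $$F_{1,f}(t)=2(2f+1)\,t(1+t)^f+8\binom f2\,t^2(1+t)^{f-2}.$$
   Context: Terms with vanishing binomial coefficient are $0$ (so for $f<2$ the second term is absent). For $n\ge1$, $\mathfrak B_n$ is the hyperoctahedral group of signed permutations: words $\pi=\pi_1\cdots\pi_n$ of nonzero integers such that $|\pi_1|,\dots,|\pi_n|$ is a permutation of $[n]=\{1,\dots,n\}$, with $\pi(i)=\pi_i$, $\pi(-i)=-\pi(i)$. $\mathcal I_n^B$ is the set of $\pi\in\mathfrak B_n$ with $\pi^2=\mathrm{id}$. With $\pi_0=0$ and the usual order on $\mathbb Z$, $\operatorname{des}^B(\pi)=\#\{0\le i\le n-1:\pi_i>\pi_{i+1}\}$. $\operatorname{fix}_B(\pi)=\#\{i\in[n]:|\pi(i)|=i\}$, and $\operatorname{cyc}_2(\pi)$ is the number of two-cycles of the ordinary involution $i\mapsto|\pi(i)|$ of $[n]$. The polynomial $F_{1,f}$ is the case $j=1$ of $$F_{j,f}(t)=\sum_{\substack{\pi\in\mathcal I_{2j+f}^B\\ \operatorname{cyc}_2(\pi)=j,\ \operatorname{fix}_B(\pi)=f}}t^{\operatorname{des}^B(\pi)}.$$ -}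

module Defs where

open import Data.Integer as ℤ using (ℤ; +_; -[1+_]; ∣_∣)
import Data.Integer.Properties as ℤ
open import Data.List using (List; []; _∷_; [_]; _++_; map; foldr; filter; length; upTo; cartesianProduct; cartesianProductWith)
open import Data.List.Membership.DecPropositional using () renaming (_∈?_ to mem?)
open import Data.List.Membership.Propositional using (_∈_)
open import Data.List.Membership.Propositional.Properties
  using (∈-∃++; ∈-++⁺ˡ; ∈-++⁺ʳ; ∈-map⁺; ∈-map⁻; ∈-filter⁺; ∈-filter⁻; ∈-cartesianProductWith⁺)
open import Data.List.Relation.Binary.Permutation.Propositional using (_↭_; ↭-refl; ↭-sym; ↭-trans; prep)
open import Data.List.Relation.Binary.Permutation.Propositional.Properties
  using (shift; drop-mid; ¬x∷xs↭[]; ∈-resp-↭)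
open import Data.List.Relation.Unary.All as All using (All; []; _∷_; all?)
open import Data.List.Relation.Unary.Any using (here; there)
open import Data.List.Relation.Unary.Unique.Propositional using (Unique; []; _∷_)
import Data.List.Relation.Unary.Unique.Propositional.Properties as Unique
open import Data.Nat as ℕ using (ℕ; zero; suc; _+_; _*_)
import Data.Nat.Properties as ℕ
open import Data.Product using (_×_; _,_; proj₁; proj₂)
open import Data.Vec using (Vec; []; _∷_; toList)
import Data.Vec.Properties as Vec
open import Function.Bundles using (_⇔_; mk⇔)
open import Relation.Binary.PropositionalEquality using (_≡_; refl)
open import Relation.Nullary using (Dec; yes; no; ¬_)
open import Relation.Nullary.Decidable using (_×-dec_)
open import Relation.Unary using (Decidable)

-- Polynomials in t over ℕ, as coefficient lists with the constant term first.
-- Trailing zeros are allowed, so the equality of polynomials is _≈_, not _≡_.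

Poly : Set
Poly = List ℕ

coeff : Poly → ℕ → ℕ
coeff []      _       = 0
coeff (a ∷ p) zero    = a
coeff (a ∷ p) (suc k) = coeff p k

infix 4 _≈_
_≈_ : Poly → Poly → Set
p ≈ q = ∀ k → coeff p k ≡ coeff q k

infixl 6 _⊕_
infixl 7 _⊗_
infixr 8 _↑_

_⊕_ : Poly → Poly → Poly
[]      ⊕ q       = q
(a ∷ p) ⊕ []      = a ∷ p
(a ∷ p) ⊕ (b ∷ q) = (a + b) ∷ (p ⊕ q)

_⊗_ : Poly → Poly → Poly
[]      ⊗ q = []
(a ∷ p) ⊗ q = map (a *_) q ⊕ (0 ∷ (p ⊗ q))

const : ℕ → Poly
const c = c ∷ []

t : Poly
t = 0 ∷ 1 ∷ []

_↑_ : Poly → ℕ → Poly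
p ↑ zero  = const 1
p ↑ suc k = p ⊗ (p ↑ k)

∑ : List Poly → Poly
∑ = foldr _⊕_ []

count : ∀ {A : Set} {P : A → Set} → Decidable P → List A → ℕ
count P? xs = length (filter P? xs)

[1⋯_] : ℕ → List ℕ
[1⋯ n ] = map suc (upTo n)

-- The letter π_k of π = π_1 ⋯ π_n, with π_0 = 0; the value 0 for k > n is a
-- dummy.
_at_ : ∀ {n} → Vec ℤ n → ℕ → ℤ
π       at zero          = + 0
[]      at suc k         = + 0
(x ∷ π) at suc zero      = x
(x ∷ π) at suc (suc k)   = π at suc k

-- π as an odd map: π(k) = π_k and π(-k) = -π_k.
_⟨_⟩ : ∀ {n} → Vec ℤ n → ℤ → ℤ
π ⟨ + k ⟩      = π at k
π ⟨ -[1+ k ] ⟩ = ℤ.- (π at suc k)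

-- Membership in 𝔅_n; the condition forces every letter to be nonzero.
SignedPermutation : ∀ {n} → Vec ℤ n → Set
SignedPermutation {n} π = map ∣_∣ (toList π) ↭ [1⋯ n ]

-- π² = id on {±1, …, ±n}.
Involutive : ∀ {n} → Vec ℤ n → Set
Involutive {n} π =
  All (λ i → π ⟨ π ⟨ + i ⟩ ⟩ ≡ + i × π ⟨ π ⟨ ℤ.- + i ⟩ ⟩ ≡ ℤ.- + i) [1⋯ n ]

desᴮ : ∀ {n} → Vec ℤ n → ℕ
desᴮ {n} π = count (λ i → (π at suc i) ℤ.<? (π at i)) (upTo n)

fixᴮ : ∀ {n} → Vec ℤ n → ℕ
fixᴮ {n} π = count (λ i → ∣ π at i ∣ ℕ.≟ i) [1⋯ n ]

-- A two-cycle of i ↦ |π(i)| is counted once, as the pair (i , k) with i < k.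
cyc₂ : ∀ {n} → Vec ℤ n → ℕ
cyc₂ {n} π =
  count (λ (i , k) → (i ℕ.<? k) ×-dec (∣ π at i ∣ ℕ.≟ k) ×-dec (∣ π at k ∣ ℕ.≟ i))
        (cartesianProduct [1⋯ n ] [1⋯ n ])

-- π ∈ 𝓘ᴮ_n with cyc₂(π) = j and fixᴮ(π) = f.
InClass : ∀ {n} → ℕ → ℕ → Vec ℤ n → Set
InClass j f π = SignedPermutation π × Involutive π × cyc₂ π ≡ j × fixᴮ π ≡ f

_↭?_ : (xs ys : List ℕ) → Dec (xs ↭ ys)
[]       ↭? []       = yes ↭-refl
[]       ↭? (y ∷ ys) = no λ p → ¬x∷xs↭[] (↭-sym p)
(x ∷ xs) ↭? ys with mem? ℕ._≟_ x ys
... | no x∉ys = no λ p → x∉ys (∈-resp-↭ p (here refl))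
... | yes x∈ys with as , bs , refl ← ∈-∃++ x∈ys with xs ↭? (as ++ bs)
...   | yes p = yes (↭-trans (prep x p) (↭-sym (shift x as bs)))
...   | no ¬p = no λ q → ¬p (drop-mid [] as q)

inClass? : ∀ {n} j f → Decidable (InClass {n} j f)
inClass? {n} j f π =
  (map ∣_∣ (toList π) ↭? [1⋯ n ])
  ×-dec all? (λ i → (π ⟨ π ⟨ + i ⟩ ⟩ ℤ.≟ + i) ×-dec (π ⟨ π ⟨ ℤ.- + i ⟩ ⟩ ℤ.≟ ℤ.- + i)) [1⋯ n ]
  ×-dec (cyc₂ π ℕ.≟ j)
  ×-dec (fixᴮ π ℕ.≟ f)

letters : ℕ → List ℤ
letters n = map +_ [1⋯ n ] ++ map (λ i → ℤ.- + i) [1⋯ n ]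

words : List ℤ → ∀ m → List (Vec ℤ m)
words as zero    = [ [] ]
words as (suc m) = cartesianProductWith _∷_ as (words as m)

-- The members of the index set of F_{j,f}; ∈-class and class-unique below show
-- that each occurs exactly once.
class : ∀ n → ℕ → ℕ → List (Vec ℤ n)
class n j f = filter (inClass? j f) (words (letters n) n)

F : ℕ → ℕ → Poly
F j f = ∑ (map (λ π → t ↑ desᴮ π) (class (2 * j + f) j f))

words-complete : ∀ as {m} (π : Vec ℤ m) → All (_∈ as) (toList π) → π ∈ words as m
words-complete as []      []       = here refl
words-complete as (x ∷ π) (p ∷ ps) = ∈-cartesianProductWith⁺ _∷_ p (words-complete as π ps)

words-unique : ∀ {as} → Unique as → ∀ m → Unique (words as m)
words-unique u zero    = [] ∷ []
words-unique u (suc m) = Unique.cartesianProductWith⁺ _∷_ Vec.∷-injective u (words-unique u m)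

∈-letters : ∀ n x → ∣ x ∣ ∈ [1⋯ n ] → x ∈ letters n
∈-letters n (+ k)      p = ∈-++⁺ˡ (∈-map⁺ +_ p)
∈-letters n (-[1+ k ]) p = ∈-++⁺ʳ (map +_ [1⋯ n ]) (∈-map⁺ (λ i → ℤ.- + i) p)

letters-unique : ∀ n → Unique (letters n)
letters-unique n =
  Unique.++⁺ (Unique.map⁺ ℤ.+-injective u)
             (Unique.map⁺ (λ eq → ℤ.+-injective (ℤ.neg-injective eq)) u)
             disjoint
  where
  u : Unique [1⋯ n ]
  u = Unique.map⁺ ℕ.suc-injective (Unique.upTo⁺ n)

  disjoint : ∀ {x} → ¬ (x ∈ map +_ [1⋯ n ] × x ∈ map (λ i → ℤ.- + i) [1⋯ n ])
  disjoint (p , q) with i , _ , refl ← ∈-map⁻ +_ p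
                   with k , k∈ , eq ← ∈-map⁻ (λ i → ℤ.- + i) q
                   with _ , _ , refl ← ∈-map⁻ suc k∈ with () ← eq

∈-class : ∀ {n} j f (π : Vec ℤ n) → π ∈ class n j f ⇔ InClass j f π
∈-class {n} j f π = mk⇔
  (λ p → proj₂ (∈-filter⁻ (inClass? j f) {xs = words (letters n) n} p))
  (λ c → ∈-filter⁺ (inClass? j f)
           (words-complete (letters n) π
             (All.tabulate λ {x} x∈ → ∈-letters n x (∈-resp-↭ (proj₁ c) (∈-map⁺ ∣_∣ x∈))))
           c)

class-unique : ∀ n j f → Unique (class n j f)
class-unique n j f = Unique.filter⁺ (inClass? j f) (words-unique (letters-unique n) n)

{-# OPTIONS --safe #-}

-- In π ∈ 𝓘ᴮ_{f+2} with the two-cycle {i < k} one has π_i = ±k and π_k = ±i with a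
-- common sign, and every other π_p is ±p.  A fixed p contributes a descent into
-- π_p exactly when its sign is negative, hence a factor 1 + t, except next to i
-- and k.  The step into π_i and the step out of it always contribute t together,
-- π_{i+1} = ±(i+1) gives a factor 2 since its sign is irrelevant, and
-- π_{k-1} = ±(k-1) is followed by a descent exactly when it is not preceded by one,
-- giving 2t.  Counting both signs of the two-cycle, the total is 2t(1+t)^f if
-- k - i ≤ 2 and 8t²(1+t)^{f-2} otherwise; there are 2f + 1 pairs of the first kind
-- and C(f,2) of the second.

module Submission where

open import Defs
open import Algebra.Bundles using (CommutativeSemiring)
import Algebra.Structures.Biased as Biased
open import Data.Bool using (if_then_else_)
open import Data.Integer as ℤ using (ℤ; +_; -[1+_]; ∣_∣; _◃_; sign; +<+; -<+; -<-)
import Data.Integer.Properties as ℤ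
open import Data.List using (List; []; _∷_; [_]; _++_; map; foldr; filter; length; concatMap; upTo; applyUpTo; cartesianProduct)
open import Data.List.Membership.Propositional using (_∈_)
open import Data.List.Membership.Propositional.Properties
  using (∈-++⁺ˡ; ∈-++⁺ʳ; ∈-++⁻; ∈-map⁺; ∈-map⁻; ∈-filter⁺; ∈-filter⁻; ∈-upTo⁺; ∈-upTo⁻; ∈-cartesianProduct⁺; ∈-cartesianProduct⁻)
open import Data.List.Membership.Propositional.Properties.WithK using (unique∧set⇒bag)
open import Data.List.Properties using (map-∘; map-upTo; length-map; length-upTo; map-id-local)
open import Data.List.Relation.Binary.BagAndSetEquality using (∼bag⇒↭)
open import Data.List.Relation.Binary.Permutation.Propositional as ↭ using (_↭_; ↭-refl; swap)
import Data.List.Relation.Binary.Permutation.Propositional.Properties as ↭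
open import Data.List.Relation.Unary.All as All using ([]; _∷_)
open import Data.List.Relation.Unary.Any using (here; there)
open import Data.List.Relation.Unary.Unique.Propositional using (Unique; []; _∷_)
import Data.List.Relation.Unary.Unique.Propositional.Properties as Unique
open import Data.Nat as ℕ using (ℕ; zero; suc; _∸_; _≤_; _<_; z≤n; s≤s; z<s)
open import Data.Nat.Combinatorics using (_C_; nC1≡n; nCk+nC[k+1]≡[n+1]C[k+1])
import Data.Nat.Properties as ℕ
open import Data.Nat.Solver using (module +-*-Solver)
open import Data.Product using (_×_; _,_; ∃-syntax; proj₁; proj₂)
open import Data.Sign as Sign using (Sign)
open import Data.Sum using (inj₁; inj₂)
open import Data.Vec using (Vec; []; _∷_; toList)
import Data.Vec.Properties as Vec
open import Function using (_∘_)
open import Function.Bundles using (mk⇔; module Equivalence)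
open import Level using (0ℓ)
open import Relation.Binary.Definitions using (tri<; tri≈; tri>)
open import Relation.Binary.PropositionalEquality as ≡ using (_≡_; _≢_)
open import Relation.Binary.Structures using (IsEquivalence)
open import Relation.Nullary using (Dec; yes; no; ¬_; does; contradiction)
open import Relation.Nullary.Decidable using (dec-true; dec-false; _×-dec_)
open import Relation.Unary using (Decidable)

-- Words with one two-cycle

-- Opaque, like factor and gf below, so that its arguments can be inferred.
opaque
  extend : ∀ {I : Set} {n} → (I → ℤ) → (I → List (Vec ℤ n)) → List I → List (Vec ℤ (suc n))
  extend head tails = concatMap (λ i → map (head i ∷_) (tails i))

signs : List Sign
signs = Sign.+ ∷ Sign.- ∷ []

-- The words below occupy the positions j+1, …, j+r of a longer word.

fixing : ∀ j r → List (Vec ℤ r)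
fixing j zero    = [ [] ]
fixing j (suc r) = extend (_◃ suc j) (λ _ → fixing (suc j) r) signs

-- The letter s(i+1), closing a two-cycle opened at position i+1 ≤ j, comes after
-- m letters fixed up to sign.
closing : ∀ (i m : ℕ) (s : Sign) (j r : ℕ) → List (Vec ℤ r)
closing i m       s j zero    = []
closing i zero    s j (suc r) = map ((s ◃ suc i) ∷_) (fixing (suc j) r)
closing i (suc m) s j (suc r) = extend (_◃ suc j) (λ _ → closing i m s (suc j) r) signs

-- A first letter s(j+m+1) is fixed up to sign if m = 0; otherwise it opens a
-- two-cycle that is closed m letters later.
swappingHead : ℕ → ℕ × Sign → ℤ
swappingHead j (m , s) = s ◃ suc (j ℕ.+ m)

mutual
  swapping : ∀ j r → List (Vec ℤ r)
  swapping j zero    = []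
  swapping j (suc r) =
    extend (swappingHead j) (swappingTails j r) (cartesianProduct (upTo (suc r)) signs)

  swappingTails : ∀ j r → ℕ × Sign → List (Vec ℤ r)
  swappingTails j r (zero  , s) = swapping (suc j) r
  swappingTails j r (suc m , s) = closing j m s (suc j) r

-- Comparison with letters of larger absolute value

big-≮ : ∀ {n} y → ∣ y ∣ ≤ n → ¬ + suc n ℤ.< y
big-≮ (+ k) k≤n (+<+ n<k) = ℕ.<⇒≱ n<k (ℕ.m≤n⇒m≤1+n k≤n)

<-big : ∀ {n} y → ∣ y ∣ ≤ n → y ℤ.< + suc n
<-big (+ k)    k≤n = +<+ (s≤s k≤n)
<-big -[1+ k ] k≤n = -<+

small-< : ∀ {n} y → ∣ y ∣ ≤ n → -[1+ n ] ℤ.< y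
small-< (+ k)    k≤n = -<+
small-< -[1+ k ] k≤n = -<- k≤n

≮-small : ∀ {n} y → ∣ y ∣ ≤ n → ¬ y ℤ.< -[1+ n ]
≮-small -[1+ k ] k≤n (-<- n<k) = ℕ.<⇒≱ n<k (ℕ.<⇒≤ k≤n)

abs-◃-≤ : ∀ s {i j} → i < j → ∣ s ◃ suc i ∣ ≤ j
abs-◃-≤ Sign.+ i<j = i<j
abs-◃-≤ Sign.- i<j = i<j

count-map : ∀ {A B : Set} {P : B → Set} (P? : Decidable P) (g : A → B) xs →
  count P? (map g xs) ≡ count (P? ∘ g) xs
count-map P? g []       = ≡.refl
count-map P? g (x ∷ xs) with P? (g x)
... | yes _ = ≡.cong suc (count-map P? g xs)
... | no  _ = count-map P? g xs

-- Generating functions by descents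

-- The computation needs only the semiring laws, so it is done in an abstract `R` with `X` in the
-- role of t; coefficient lists and `t` are substituted at the end.
module GeneratingFunction {c ℓ} (R : CommutativeSemiring c ℓ) (X : CommutativeSemiring.Carrier R) where

  open CommutativeSemiring R renaming (_≈_ to _≋_)
  open import Algebra.Properties.Semiring.Mult semiring using (×-homo-+; ×1-homo-*) renaming (_×_ to _·_)
  open import Algebra.Properties.Semiring.Exp semiring using (_^_)
  open import Algebra.Solver.Ring.NaturalCoefficients.Default R
    using (solve; Polynomial; _:=_; _:+_; _:*_; con)
  open import Relation.Binary.Reasoning.Setoid setoid

  -- Finite sums in the semiring

  Σ⟨_⟩ : ∀ {A : Set} → (A → Carrier) → List A → Carrier
  Σ⟨ g ⟩ xs = foldr _+_ 0# (map g xs)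

  Σ-++ : ∀ {A : Set} (g : A → Carrier) xs ys → Σ⟨ g ⟩ (xs ++ ys) ≋ Σ⟨ g ⟩ xs + Σ⟨ g ⟩ ys
  Σ-++ g []       ys = sym (+-identityˡ _)
  Σ-++ g (x ∷ xs) ys = trans (+-congˡ (Σ-++ g xs ys)) (sym (+-assoc _ _ _))

  Σ-cong : ∀ {A : Set} {g h : A → Carrier} → (∀ x → g x ≋ h x) → ∀ xs → Σ⟨ g ⟩ xs ≋ Σ⟨ h ⟩ xs
  Σ-cong e []       = refl
  Σ-cong e (x ∷ xs) = +-cong (e x) (Σ-cong e xs)

  Σ-↭ : ∀ {A : Set} (g : A → Carrier) {xs ys} → xs ↭ ys → Σ⟨ g ⟩ xs ≋ Σ⟨ g ⟩ ys
  Σ-↭ g ↭.refl          = refl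
  Σ-↭ g (↭.prep x p)    = +-congˡ (Σ-↭ g p)
  Σ-↭ g (↭.swap x y p)  = trans (+-congˡ (+-congˡ (Σ-↭ g p)))
    (solve 3 (λ a b s → a :+ (b :+ s) := b :+ (a :+ s)) refl (g x) (g y) _)
  Σ-↭ g (↭.trans p q)   = trans (Σ-↭ g p) (Σ-↭ g q)

  Σ-applyUpTo-const : ∀ {A : Set} (g : A → Carrier) (h : ℕ → A) r {b} →
    (∀ {k} → k < r → g (h k) ≋ b) → Σ⟨ g ⟩ (applyUpTo h r) ≋ (r · 1#) * b
  Σ-applyUpTo-const g h zero    e = sym (zeroˡ _)
  Σ-applyUpTo-const g h (suc r) {b} e = begin
    g (h 0) + Σ⟨ g ⟩ (applyUpTo (h ∘ suc) r) ≈⟨ +-cong (e ℕ.z<s) (Σ-applyUpTo-const g (h ∘ suc) r (e ∘ s≤s)) ⟩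
    b + (r · 1#) * b                         ≈⟨ solve 2 (λ x y → x :+ y :* x := (con 1 :+ y) :* x) refl b (r · 1#) ⟩
    (suc r · 1#) * b                         ∎

  Σ-signs : ∀ {A : Set} (g : A × Sign → Carrier) xs →
    Σ⟨ g ⟩ (cartesianProduct xs signs) ≋ Σ⟨ (λ x → g (x , Sign.+) + g (x , Sign.-)) ⟩ xs
  Σ-signs g []       = refl
  Σ-signs g (x ∷ xs) = trans (+-congˡ (+-congˡ (Σ-signs g xs))) (sym (+-assoc _ _ _))

  -- Weights of words

  opaque
    factor : ℤ → ℤ → Carrier
    factor x y = if does (y ℤ.<? x) then X else 1#

    descent : ∀ {x y} → y ℤ.< x → factor x y ≋ X
    descent {x} {y} y<x = reflexive (≡.cong (if_then X else 1#) (dec-true (y ℤ.<? x) y<x))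

    ascent : ∀ {x y} → ¬ y ℤ.< x → factor x y ≋ 1#
    ascent {x} {y} y≮x = reflexive (≡.cong (if_then X else 1#) (dec-false (y ℤ.<? x) y≮x))

  weight : ∀ {n} → ℤ → Vec ℤ n → Carrier
  weight x []      = 1#
  weight x (y ∷ w) = factor x y * weight y w

  opaque
    -- x is the letter in front of the words.
    gf : ∀ {n} → ℤ → List (Vec ℤ n) → Carrier
    gf x = Σ⟨ weight x ⟩

  opaque
    unfolding extend gf

    gf≋Σ : ∀ {n} x (ws : List (Vec ℤ n)) → gf x ws ≋ Σ⟨ weight x ⟩ ws
    gf≋Σ x ws = refl

    gf-none : ∀ {n} x → gf {n} x [] ≋ 0#
    gf-none x = refl

    gf-[] : ∀ x → gf x [ [] ] ≋ 1#
    gf-[] x = +-identityʳ _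

    gf-∷ : ∀ {n} x y (ws : List (Vec ℤ n)) → gf x (map (y ∷_) ws) ≋ factor x y * gf y ws
    gf-∷ x y []       = sym (zeroʳ _)
    gf-∷ x y (w ∷ ws) = trans (+-congˡ (gf-∷ x y ws)) (sym (distribˡ _ _ _))

    gf-extend : ∀ {I : Set} {n} x head (tails : I → List (Vec ℤ n)) is →
      gf x (extend head tails is) ≋ Σ⟨ (λ i → factor x (head i) * gf (head i) (tails i)) ⟩ is
    gf-extend x head tails []       = refl
    gf-extend x head tails (i ∷ is) =
      trans (Σ-++ (weight x) (map (head i ∷_) (tails i)) _)
            (+-cong (gf-∷ x (head i) (tails i)) (gf-extend x head tails is))

  -- Series of words with letters fixed up to sign and of words closing a two-cycle

  module _ {n} (j : ℕ) (tails : Sign → List (Vec ℤ n)) where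

    gf-signs : ∀ x {a b} → factor x (+ suc j) ≋ a → factor x -[1+ j ] ≋ b →
      gf x (extend (_◃ suc j) tails signs)
        ≋ a * gf (+ suc j) (tails Sign.+) + b * gf -[1+ j ] (tails Sign.-)
    gf-signs x ea eb = trans (gf-extend x (_◃ suc j) tails signs)
      (+-cong (*-congʳ ea) (trans (+-identityʳ _) (*-congʳ eb)))

    -- Since -(j+1) < x < j+1, the step from `x` is an ascent to the positive letter and a descent
    -- to the negative one.
    gf-signs-≤ : ∀ x → ∣ x ∣ ≤ j →
      gf x (extend (_◃ suc j) tails signs)
        ≋ 1# * gf (+ suc j) (tails Sign.+) + X * gf -[1+ j ] (tails Sign.-)
    gf-signs-≤ x x≤j = gf-signs x (ascent (big-≮ x x≤j)) (descent (small-< x x≤j))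

  -- Each letter exceeds its predecessor in absolute value, so the step into it is a descent exactly
  -- when it is negative.
  gf-fixing : ∀ j r x → ∣ x ∣ ≤ j → gf x (fixing j r) ≋ (1# + X) ^ r
  gf-fixing j zero    x x≤j = gf-[] x
  gf-fixing j (suc r) x x≤j = begin
    gf x (fixing j (suc r))
      ≈⟨ gf-signs-≤ j _ x x≤j ⟩
    1# * gf (+ suc j) (fixing (suc j) r) + X * gf -[1+ j ] (fixing (suc j) r)
      ≈⟨ +-cong (*-congˡ (gf-fixing (suc j) r (+ suc j) ℕ.≤-refl)) (*-congˡ (gf-fixing (suc j) r -[1+ j ] ℕ.≤-refl)) ⟩
    1# * (1# + X) ^ r + X * (1# + X) ^ r
      ≈⟨ distribʳ _ _ _ ⟨
    (1# + X) ^ suc r ∎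

  -- The closing letter may be smaller than `x` in absolute value, so its sign does not decide the
  -- step into it; that factor stays a parameter `a`. The letters after it are again larger.
  gf-closing-0 : ∀ {i j} s r x {a} → i < j → factor x (s ◃ suc i) ≋ a →
    gf x (closing i 0 s j (suc r)) ≋ a * (1# + X) ^ r
  gf-closing-0 {i} {j} s r x i<j e = trans (gf-∷ x (s ◃ suc i) (fixing (suc j) r))
    (*-cong e (gf-fixing (suc j) r _ (abs-◃-≤ s (ℕ.m<n⇒m<1+n i<j))))

  -- Only the last letter before the closing one is special: for either sign, exactly one of the
  -- steps into and out of it is a descent, which gives X + X. The other r letters fixed up to sign
  -- give 1 + X each, so the result does not depend on m.
  gf-closing-suc : ∀ {i j} m s r x → i < j → ∣ x ∣ ≤ j → m ≤ r →
    gf x (closing i (suc m) s j (suc (suc r))) ≋ (X + X) * (1# + X) ^ r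
  gf-closing-suc {i} {j} zero s r x i<j x≤j _ = begin
    gf x (closing i 1 s j (suc (suc r)))
      ≈⟨ gf-signs-≤ j _ x x≤j ⟩
    1# * gf (+ suc j) (closing i 0 s (suc j) (suc r)) + X * gf -[1+ j ] (closing i 0 s (suc j) (suc r))
      ≈⟨ +-cong (*-congˡ (gf-closing-0 s r _ (ℕ.m<n⇒m<1+n i<j) (descent (<-big _ (abs-◃-≤ s i<j)))))
                (*-congˡ (gf-closing-0 s r _ (ℕ.m<n⇒m<1+n i<j) (ascent (≮-small _ (abs-◃-≤ s i<j))))) ⟩
    1# * (X * (1# + X) ^ r) + X * (1# * (1# + X) ^ r)
      ≈⟨ solve 2 (λ x p → con 1 :* (x :* p) :+ x :* (con 1 :* p) := (x :+ x) :* p) refl X _ ⟩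
    (X + X) * (1# + X) ^ r ∎
  gf-closing-suc {i} {j} (suc m) s (suc r) x i<j x≤j (s≤s m≤r) = begin
    gf x (closing i (suc (suc m)) s j (suc (suc (suc r))))
      ≈⟨ gf-signs-≤ j _ x x≤j ⟩
    1# * gf (+ suc j) (closing i (suc m) s (suc j) (suc (suc r))) + X * gf -[1+ j ] (closing i (suc m) s (suc j) (suc (suc r)))
      ≈⟨ +-cong (*-congˡ (gf-closing-suc m s r _ (ℕ.m<n⇒m<1+n i<j) ℕ.≤-refl m≤r))
                (*-congˡ (gf-closing-suc m s r _ (ℕ.m<n⇒m<1+n i<j) ℕ.≤-refl m≤r)) ⟩
    1# * ((X + X) * (1# + X) ^ r) + X * ((X + X) * (1# + X) ^ r)
      ≈⟨ solve 2 (λ x p → con 1 :* ((x :+ x) :* p) :+ x :* ((x :+ x) :* p) := (x :+ x) :* ((con 1 :+ x) :* p)) refl X _ ⟩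
    (X + X) * (1# + X) ^ suc r ∎

  -- Both signs of a letter ±(k+1) that follows x and opens a two-cycle.
  gf-opening : ℤ → ℕ → ℕ → ℕ → ℕ → ℕ → Carrier
  gf-opening x k i m j r = term Sign.+ + term Sign.-
    where
    term : Sign → Carrier
    term s = factor x (s ◃ suc k) * gf (s ◃ suc k) (closing i m s j r)

  gf-opening-cong : ∀ {x k i j} m r {a b} → ∣ x ∣ ≤ k →
    gf (+ suc k) (closing i m Sign.+ j r) ≋ a → gf -[1+ k ] (closing i m Sign.- j r) ≋ b →
    gf-opening x k i m j r ≋ a + X * b
  gf-opening-cong m r x≤k ea eb = +-cong
    (trans (*-cong (ascent (big-≮ _ x≤k)) ea) (*-identityˡ _))
    (*-cong (descent (small-< _ x≤k)) eb)

  -- The opening letter ±(k+1) exceeds both neighbours in absolute value, so exactly one of the two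
  -- steps at it is a descent, for either sign.
  gf-opening-0 : ∀ {x k i j} r → ∣ x ∣ ≤ k → i < j → j ≤ k →
    gf-opening x k i 0 j (suc r) ≋ (X + X) * (1# + X) ^ r
  gf-opening-0 r x≤k i<j j≤k = trans
    (gf-opening-cong 0 (suc r) x≤k
      (gf-closing-0 Sign.+ r _ i<j (descent (<-big _ i<k)))
      (gf-closing-0 Sign.- r _ i<j (ascent (≮-small _ i<k))))
    (solve 2 (λ x p → x :* p :+ x :* (con 1 :* p) := (x :+ x) :* p) refl X _)
    where i<k = ℕ.<-≤-trans i<j j≤k

  -- The next letter ±(j+1) is smaller in absolute value, so the sign of the opening letter alone
  -- decides the step out of it. Here `a` and `b` are the series of the remaining words after +(j+1)
  -- and after -(j+1).
  gf-opening-suc : ∀ {x k i j} m r {a b} → ∣ x ∣ ≤ k → j < k →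
    (∀ s → gf (+ suc j) (closing i m s (suc j) r) ≋ a) →
    (∀ s → gf -[1+ j ] (closing i m s (suc j) r) ≋ b) →
    gf-opening x k i (suc m) j (suc r) ≋ (X + X) * (a + b)
  gf-opening-suc {x} {k} {i} {j} m r {a} {b} x≤k j<k ea eb = trans
    (gf-opening-cong (suc m) (suc r) x≤k
      (trans (gf-signs j _ _ (descent (<-big _ j<k)) (descent (<-big _ j<k)))
             (+-cong (*-congˡ (ea Sign.+)) (*-congˡ (eb Sign.+))))
      (trans (gf-signs j _ _ (ascent (≮-small _ j<k)) (ascent (≮-small _ j<k)))
             (+-cong (*-congˡ (ea Sign.-)) (*-congˡ (eb Sign.-)))))
    (solve 3 (λ x a b → (x :* a :+ x :* b) :+ x :* (con 1 :* a :+ con 1 :* b) := (x :+ x) :* (a :+ b)) refl X a b)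

  -- The only letter inside the two-cycle is followed by a descent exactly when it is positive,
  -- which restores a factor 1 + X.
  gf-opening-1 : ∀ {x k i j} r → ∣ x ∣ ≤ k → i < j → j < k →
    gf-opening x k i 1 j (suc (suc r)) ≋ (X + X) * (1# + X) ^ suc r
  gf-opening-1 r x≤k i<j j<k = trans
    (gf-opening-suc 0 (suc r) x≤k j<k
      (λ s → gf-closing-0 s r _ (ℕ.m<n⇒m<1+n i<j) (descent (<-big _ (abs-◃-≤ s i<j))))
      (λ s → gf-closing-0 s r _ (ℕ.m<n⇒m<1+n i<j) (ascent (≮-small _ (abs-◃-≤ s i<j)))))
    (solve 2 (λ x p → (x :+ x) :* (x :* p :+ con 1 :* p) := (x :+ x) :* ((con 1 :+ x) :* p)) refl X _)

  -- Now the letter after the opening one and the letter before the closing one are distinct. The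
  -- sign of the former is irrelevant and doubles the series; the latter gives X + X. The total is
  -- 8X²(1 + X)^r, whatever m is.
  gf-opening-2+ : ∀ {x k i j} m r → ∣ x ∣ ≤ k → i < j → j < k → m ≤ r →
    gf-opening x k i (2 ℕ.+ m) j (suc (suc (suc r)))
      ≋ (X + X) * ((X + X) * (1# + X) ^ r + (X + X) * (1# + X) ^ r)
  gf-opening-2+ m r x≤k i<j j<k m≤r = gf-opening-suc (suc m) (suc (suc r)) x≤k j<k
    (λ s → gf-closing-suc m s r _ (ℕ.m<n⇒m<1+n i<j) ℕ.≤-refl m≤r)
    (λ s → gf-closing-suc m s r _ (ℕ.m<n⇒m<1+n i<j) ℕ.≤-refl m≤r)

  -- Recursion on the first letter of a word with one two-cycle

  gf-swapping-suc : ∀ j r x → ∣ x ∣ ≤ j →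
    gf x (swapping j (suc r)) ≋
      (gf (+ suc (j ℕ.+ 0)) (swapping (suc j) r) + X * gf -[1+ j ℕ.+ 0 ] (swapping (suc j) r))
      + Σ⟨ (λ m → gf-opening x (j ℕ.+ suc m) j m (suc j) r) ⟩ (upTo r)
  gf-swapping-suc j r x x≤j = begin
    gf x (swapping j (suc r))
      ≈⟨ gf-extend x (swappingHead j) (swappingTails j r) (cartesianProduct (upTo (suc r)) signs) ⟩
    Σ⟨ term ⟩ (cartesianProduct (upTo (suc r)) signs)
      ≈⟨ Σ-signs term (upTo (suc r)) ⟩
    pair 0 + Σ⟨ pair ⟩ (applyUpTo suc r)
      -- The summand m = 0 has a first letter fixed up to sign; its value reads `suc (j + 0)`, which
      -- does not reduce to `suc j`. The other summands are reindexed from 0.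
      ≈⟨ +-cong (+-cong (trans (*-congʳ (ascent (big-≮ x x≤j+0))) (*-identityˡ _))
                        (*-congʳ (descent (small-< x x≤j+0))))
                (reflexive (≡.cong (foldr _+_ 0#) (≡.trans (≡.cong (map pair) (≡.sym (map-upTo suc r))) (≡.sym (map-∘ (upTo r)))))) ⟩
    _ ∎
    where
    term : ℕ × Sign → Carrier
    term i = factor x (swappingHead j i) * gf (swappingHead j i) (swappingTails j r i)
    pair : ℕ → Carrier
    pair m = term (m , Sign.+) + term (m , Sign.-)
    x≤j+0 = ℕ.≤-trans x≤j (ℕ.m≤m+n j 0)

  -- The closed form and its recursion

  2# : Carrier
  2# = 1# + 1#

  -- The coefficients are built from `2#`, which is the meaning of `con 2`, to suit the solver. The
  -- truncation in `f ∸ 2` is harmless because C(f,2) = 0 for f < 2.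
  swapPolynomial : ℕ → Carrier
  swapPolynomial f =
    2# * (2# * (f · 1#) + 1#) * X * (1# + X) ^ f
    + 2# * 2# * 2# * ((f C 2) · 1#) * (X * X) * (1# + X) ^ (f ∸ 2)

  -- The words of length f+3 whose first letter opens the two-cycle: it closes
  -- at distance 1, at distance 2, or at one of f larger distances.
  openings : ℕ → Carrier
  openings f = (X + X) * (1# + X) ^ suc f + ((X + X) * (1# + X) ^ suc f
    + (f · 1#) * ((X + X) * ((X + X) * (1# + X) ^ (f ∸ 1) + (X + X) * (1# + X) ^ (f ∸ 1))))

  -- n, c, p and q stand for f, C(f,2), (1+X)^f and (1+X)^(f∸2).
  swapSyntax : ∀ {k} (x n c p q : Polynomial k) → Polynomial k
  swapSyntax x n c p q = con 2 :* (con 2 :* n :+ con 1) :* x :* p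
    :+ con 2 :* con 2 :* con 2 :* c :* (x :* x) :* q

  -- The shape of the left-hand side of `swapPolynomial-suc`, with `q′` for (1+X)^(f∸1).
  swapSumSyntax : ∀ {k} (x n c p q q′ : Polynomial k) → Polynomial k
  swapSumSyntax x n c p q q′ = (swapSyntax x n c p q :+ x :* swapSyntax x n c p q)
    :+ ((x :+ x) :* ((con 1 :+ x) :* p) :+ ((x :+ x) :* ((con 1 :+ x) :* p)
        :+ n :* ((x :+ x) :* ((x :+ x) :* q′ :+ (x :+ x) :* q′))))

  -- The first terms match since 2(2f+1) + 4 = 2(2f+3), the second by Pascal's rule f + C(f,2) =
  -- C(f+1,2). The cases f = 0 and f = 1 are separate because the exponents `f ∸ 1` and `f ∸ 2` are
  -- truncated there.
  swapPolynomial-suc : ∀ f →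
    (swapPolynomial f + X * swapPolynomial f) + openings f ≋ swapPolynomial (suc f)
  swapPolynomial-suc 0 = solve 1 (λ x → swapSumSyntax x (con 0) (con 0) (con 1) (con 1) (con 1)
      := swapSyntax x (con 1 :+ con 0) (con 0) ((con 1 :+ x) :* con 1) (con 1)) refl X
  swapPolynomial-suc 1 = solve 1 (λ x →
      let p = (con 1 :+ x) :* con 1 in
      swapSumSyntax x (con 1 :+ con 0) (con 0) p (con 1) (con 1)
      := swapSyntax x (con 1 :+ (con 1 :+ con 0)) (con 1 :+ con 0) ((con 1 :+ x) :* p) (con 1)) refl X
  swapPolynomial-suc f@(suc (suc g)) = begin
    (swapPolynomial f + X * swapPolynomial f) + openings f
      ≈⟨ solve 4 (λ x n c q →
           let p = (con 1 :+ x) :* ((con 1 :+ x) :* q) in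
           swapSumSyntax x n c p q ((con 1 :+ x) :* q)
           := swapSyntax x (con 1 :+ n) (n :+ c) ((con 1 :+ x) :* p) ((con 1 :+ x) :* q))
           refl X (f · 1#) ((f C 2) · 1#) ((1# + X) ^ g) ⟩
    2# * (2# * (suc f · 1#) + 1#) * X * (1# + X) ^ suc f
      + 2# * 2# * 2# * (f · 1# + (f C 2) · 1#) * (X * X) * (1# + X) ^ suc g
      ≈⟨ +-congˡ (*-congʳ (*-congʳ (*-congˡ pascal))) ⟩
    swapPolynomial (suc f) ∎
    where
    pascal : f · 1# + (f C 2) · 1# ≋ (suc f C 2) · 1#
    pascal = trans (sym (×-homo-+ 1# f (f C 2))) (reflexive (≡.cong (_· 1#)
      (≡.trans (≡.cong (ℕ._+ f C 2) (≡.sym (nC1≡n f))) (nCk+nC[k+1]≡[n+1]C[k+1] f 1))))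

  -- Indexed by the length of the words: fewer than two letters leave no room for a two-cycle.
  swapSeries : ℕ → Carrier
  swapSeries (suc (suc f)) = swapPolynomial f
  swapSeries _             = 0#

  -- The value depends on neither j nor x, so the recursion closes up: a first letter fixed up to
  -- sign multiplies the shorter series by 1 + X, and an opening first letter adds `openings`.
  gf-swapping : ∀ j r x → ∣ x ∣ ≤ j → gf x (swapping j r) ≋ swapSeries r
  gf-swapping j zero    x x≤j = gf-none x
  gf-swapping j (suc r) x x≤j = begin
    gf x (swapping j (suc r))
      ≈⟨ gf-swapping-suc j r x x≤j ⟩
    (gf (+ suc (j ℕ.+ 0)) (swapping (suc j) r) + X * gf -[1+ j ℕ.+ 0 ] (swapping (suc j) r))
      + Σ⟨ opening r ⟩ (upTo r)
      ≈⟨ +-congʳ (+-cong (gf-swapping (suc j) r _ j+0≤) (*-congˡ (gf-swapping (suc j) r _ j+0≤))) ⟩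
    (swapSeries r + X * swapSeries r) + Σ⟨ opening r ⟩ (upTo r)
      ≈⟨ sum-openings r ⟩
    swapSeries (suc r) ∎
    where
    opening : ℕ → ℕ → Carrier
    opening r m = gf-opening x (j ℕ.+ suc m) j m (suc j) r

    j+0≤ : suc (j ℕ.+ 0) ≤ suc j
    j+0≤ = s≤s (ℕ.≤-reflexive (ℕ.+-identityʳ j))

    x≤ : ∀ m → ∣ x ∣ ≤ j ℕ.+ m
    x≤ m = ℕ.≤-trans x≤j (ℕ.m≤m+n j m)

    1+j< : ∀ m → suc j < j ℕ.+ suc (suc m)
    1+j< m rewrite ℕ.+-suc j (suc m) | ℕ.+-suc j m = s≤s (s≤s (ℕ.m≤m+n j m))

    opening-0 : ∀ r → opening (suc r) 0 ≋ (X + X) * (1# + X) ^ r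
    opening-0 r = gf-opening-0 r (x≤ 1) ℕ.≤-refl (ℕ.≤-reflexive (ℕ.+-comm 1 j))

    sum-openings-2+ : ∀ f → Σ⟨ opening (2 ℕ.+ f) ⟩ (applyUpTo (2 ℕ.+_) f)
      ≋ (f · 1#) * ((X + X) * ((X + X) * (1# + X) ^ (f ∸ 1) + (X + X) * (1# + X) ^ (f ∸ 1)))
    sum-openings-2+ zero    = sym (zeroˡ _)
    -- All distances from 3 on contribute the same series, so only their number f + 1 matters.
    sum-openings-2+ (suc f) = Σ-applyUpTo-const (opening (3 ℕ.+ f)) (2 ℕ.+_) (suc f)
      (λ {k} k<1+f → gf-opening-2+ k f (x≤ (3 ℕ.+ k)) ℕ.≤-refl (1+j< (suc k)) (ℕ.≤-pred k<1+f))

    sum-openings : ∀ r →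
      (swapSeries r + X * swapSeries r) + Σ⟨ opening r ⟩ (upTo r) ≋ swapSeries (suc r)
    sum-openings 0 = solve 1 (λ x → (con 0 :+ x :* con 0) :+ con 0 := con 0) refl X
    sum-openings 1 = trans (+-congˡ (+-congʳ (opening-0 0)))
      (solve 1 (λ x → (con 0 :+ x :* con 0) :+ ((x :+ x) :* con 1 :+ con 0)
                      := swapSyntax x (con 0) (con 0) (con 1) (con 1)) refl X)
    sum-openings (suc (suc f)) = trans
      (+-congˡ (+-cong (opening-0 (suc f))
        (+-cong (gf-opening-1 f (x≤ 2) ℕ.≤-refl (1+j< 0)) (sum-openings-2+ f))))
      (swapPolynomial-suc f)

  -- Descent numbers as weights

  X^-count-∷ : ∀ (h : ℕ → ℤ) k ks →
    let descents = count (λ i → h (suc i) ℤ.<? h i) in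
    X ^ descents (k ∷ ks) ≋ factor (h k) (h (suc k)) * X ^ descents ks
  X^-count-∷ h k ks with h (suc k) ℤ.<? h k
  ... | yes desc = *-congʳ (sym (descent desc))
  ... | no  asc  = sym (trans (*-congʳ (ascent asc)) (*-identityˡ _))

  -- For the induction `π at_` is replaced by a function `h` whose value at 0 is free: passing to
  -- the tail shifts `h`, and the dropped letter becomes the new `h 0`.
  X^-descents : ∀ (h : ℕ → ℤ) {n} (π : Vec ℤ n) → (∀ k → h (suc k) ≡ π at suc k) →
    X ^ count (λ i → h (suc i) ℤ.<? h i) (upTo n) ≋ weight (h 0) π
  X^-descents h []              e = refl
  X^-descents h {suc n} (y ∷ π) e = begin
    X ^ count descent? (upTo (suc n))
      ≈⟨ X^-count-∷ h 0 (applyUpTo suc n) ⟩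
    factor (h 0) (h 1) * X ^ count descent? (applyUpTo suc n)
      ≡⟨ ≡.cong (λ ks → factor (h 0) (h 1) * X ^ count descent? ks) (map-upTo suc n) ⟨
    factor (h 0) (h 1) * X ^ count descent? (map suc (upTo n))
      ≡⟨ ≡.cong (λ d → factor (h 0) (h 1) * X ^ d) (count-map descent? suc (upTo n)) ⟩
    factor (h 0) (h 1) * X ^ count (descent? ∘ suc) (upTo n)
      ≈⟨ *-congˡ (X^-descents (h ∘ suc) π (e ∘ suc)) ⟩
    factor (h 0) (h 1) * weight (h 1) π
      ≡⟨ ≡.cong (λ z → factor (h 0) z * weight z π) (e 0) ⟩
    weight (h 0) (y ∷ π) ∎
    where
    descent? : ∀ i → Dec (h (suc i) ℤ.< h i)
    descent? i = h (suc i) ℤ.<? h i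

  X^-desᴮ : ∀ {n} (π : Vec ℤ n) → X ^ desᴮ π ≋ weight (+ 0) π
  X^-desᴮ π = X^-descents (π at_) π (λ _ → ≡.refl)

  Σ-desᴮ : ∀ {n} (ws : List (Vec ℤ n)) → Σ⟨ (λ π → X ^ desᴮ π) ⟩ ws ≋ gf (+ 0) ws
  Σ-desᴮ ws = trans (Σ-cong X^-desᴮ ws) (sym (gf≋Σ _ ws))

  swapPolynomial≋ : ∀ f → swapPolynomial f ≋
    ((2 ℕ.* (2 ℕ.* f ℕ.+ 1)) · 1#) * X * (1# + X) ^ f
    + ((8 ℕ.* (f C 2)) · 1#) * X ^ 2 * (1# + X) ^ (f ∸ 2)
  swapPolynomial≋ f = begin
    swapPolynomial f
      ≈⟨ solve 5 (λ x n c p q →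
           -- n · 1# ends in + 0#, unlike the meaning of con n.
           let two = con 1 :+ (con 1 :+ con 0) in
           swapSyntax x n c p q
           := two :* (two :* n :+ (con 1 :+ con 0)) :* x :* p
              :+ (con 1 :+ (con 1 :+ (con 1 :+ (con 1 :+ (con 1 :+ (con 1 :+ (con 1 :+ (con 1 :+ con 0)))))))) :* c
                 :* (x :* (x :* con 1)) :* q)
           refl X (f · 1#) ((f C 2) · 1#) _ _ ⟩
    (2 · 1#) * ((2 · 1#) * (f · 1#) + 1 · 1#) * X * (1# + X) ^ f
      + (8 · 1#) * ((f C 2) · 1#) * X ^ 2 * (1# + X) ^ (f ∸ 2)
      ≈⟨ +-cong (*-congʳ (*-congʳ odd)) (*-congʳ (*-congʳ (×1-homo-* 8 (f C 2)))) ⟨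
    ((2 ℕ.* (2 ℕ.* f ℕ.+ 1)) · 1#) * X * (1# + X) ^ f
    + ((8 ℕ.* (f C 2)) · 1#) * X ^ 2 * (1# + X) ^ (f ∸ 2) ∎
    where
    odd : (2 ℕ.* (2 ℕ.* f ℕ.+ 1)) · 1# ≋ (2 · 1#) * ((2 · 1#) * (f · 1#) + 1 · 1#)
    odd = trans (×1-homo-* 2 (2 ℕ.* f ℕ.+ 1))
      (*-congˡ (trans (×-homo-+ 1# (2 ℕ.* f) 1) (+-congʳ (×1-homo-* 2 f))))

open import Data.Nat using (_+_; _*_)
open ≡ using (refl; sym; trans; cong; cong₂; subst; module ≡-Reasoning)

-- Words with one two-cycle, letter by letter

private variable
  I : Set
  n r : ℕ

opaque
  unfolding extend

  ∈-extend⁺ : ∀ (head : I → ℤ) (tails : I → List (Vec ℤ n)) {is i w} →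
    i ∈ is → w ∈ tails i → (head i ∷ w) ∈ extend head tails is
  ∈-extend⁺ head tails (here refl) w∈ = ∈-++⁺ˡ (∈-map⁺ _ w∈)
  ∈-extend⁺ head tails {is = i ∷ is} (there i∈) w∈ =
    ∈-++⁺ʳ (map (head i ∷_) (tails i)) (∈-extend⁺ head tails i∈ w∈)

  ∈-extend⁻ : ∀ (head : I → ℤ) (tails : I → List (Vec ℤ n)) is {x w} →
    (x ∷ w) ∈ extend head tails is → ∃[ i ] i ∈ is × x ≡ head i × w ∈ tails i
  ∈-extend⁻ head tails (i ∷ is) v∈ with ∈-++⁻ (map (head i ∷_) (tails i)) v∈
  ... | inj₁ v∈ˡ with _ , w∈ , refl ← ∈-map⁻ _ v∈ˡ = i , here refl , refl , w∈
  ... | inj₂ v∈ʳ with k , k∈ , eq , w∈ ← ∈-extend⁻ head tails is v∈ʳ = k , there k∈ , eq , w∈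

  -- Words from different indices already differ in the first letter, so the blocks are disjoint.
  extend-unique : ∀ {head : I → ℤ} {tails : I → List (Vec ℤ n)} {is} →
    (∀ {i k} → head i ≡ head k → i ≡ k) → Unique is → (∀ i → Unique (tails i)) →
    Unique (extend head tails is)
  extend-unique inj [] u = []
  extend-unique {head = head} {tails} {i ∷ is} inj (i∉ ∷ uis) u =
    Unique.++⁺ (Unique.map⁺ Vec.∷-injectiveʳ (u i)) (extend-unique inj uis u) disjoint
    where
    disjoint : ∀ {v} → ¬ (v ∈ map (head i ∷_) (tails i) × v ∈ extend head tails is)
    disjoint (p , q) with _ , _ , refl ← ∈-map⁻ _ p
                     with k , k∈ , eq , _ ← ∈-extend⁻ head tails is q = All.lookup i∉ k∈ (inj eq)

∈-signs : ∀ s → s ∈ signs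
∈-signs Sign.+ = here refl
∈-signs Sign.- = there (here refl)

signs-unique : Unique signs
signs-unique = ((λ ()) ∷ []) ∷ [] ∷ []

-- A nonzero integer determines its sign; at 0 the two signs would coincide.
◃-suc-injective : ∀ {s s′ k k′} → s ◃ suc k ≡ s′ ◃ suc k′ → s ≡ s′ × k ≡ k′
◃-suc-injective {Sign.+} {Sign.+} refl = refl , refl
◃-suc-injective {Sign.-} {Sign.-} refl = refl , refl

-- Absence of repetitions

fixing-unique : ∀ j r → Unique (fixing j r)
fixing-unique j zero    = [] ∷ []
fixing-unique j (suc r) =
  extend-unique (proj₁ ∘ ◃-suc-injective) signs-unique (λ _ → fixing-unique (suc j) r)

closing-unique : ∀ i m s j r → Unique (closing i m s j r)
closing-unique i m       s j zero    = []
closing-unique i zero    s j (suc r) = Unique.map⁺ Vec.∷-injectiveʳ (fixing-unique (suc j) r)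
closing-unique i (suc m) s j (suc r) =
  extend-unique (proj₁ ∘ ◃-suc-injective) signs-unique (λ _ → closing-unique i m s (suc j) r)

swapping-unique : ∀ j r → Unique (swapping j r)
swapping-unique j zero    = []
swapping-unique j (suc r) =
  extend-unique injective (Unique.cartesianProduct⁺ (Unique.upTo⁺ (suc r)) signs-unique) tails
  where
  injective : ∀ {x y} → swappingHead j x ≡ swappingHead j y → x ≡ y
  injective {m , s} {m′ , s′} eq with refl , eq′ ← ◃-suc-injective {s} {s′} eq =
    cong (_, s) (ℕ.+-cancelˡ-≡ j _ _ eq′)

  tails : ∀ x → Unique (swappingTails j r x)
  tails (zero  , s) = swapping-unique (suc j) r
  tails (suc m , s) = closing-unique j m s (suc j) r

-- Membership expressed by positions

abs≡⇒◃ : ∀ x {k} → ∣ x ∣ ≡ k → x ≡ sign x ◃ k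
abs≡⇒◃ x refl = sym (ℤ.◃-inverse x)

∈-extend-signs⁺ : ∀ {j x w} {ws : List (Vec ℤ n)} → ∣ x ∣ ≡ suc j → w ∈ ws →
  (x ∷ w) ∈ extend (_◃ suc j) (λ _ → ws) signs
∈-extend-signs⁺ {j = j} {x} {w} {ws} ∣x∣ w∈ =
  subst (λ y → (y ∷ w) ∈ extend (_◃ suc j) (λ _ → ws) signs) (sym (abs≡⇒◃ x ∣x∣))
        (∈-extend⁺ (_◃ suc j) (λ _ → ws) (∈-signs (sign x)) w∈)

∈-extend-signs⁻ : ∀ {j x w} {ws : List (Vec ℤ n)} →
  (x ∷ w) ∈ extend (_◃ suc j) (λ _ → ws) signs → ∣ x ∣ ≡ suc j × w ∈ ws
∈-extend-signs⁻ {j = j} {ws = ws} v∈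
  with s , _ , refl , w∈ ← ∈-extend⁻ (_◃ suc j) (λ _ → ws) signs v∈ = ℤ.abs-◃ s (suc j) , w∈

-- The k-th letter of the word π, counted from 0, stands at position j+k+1.

FixedAt : ℕ → Vec ℤ r → ℕ → Set
FixedAt j π p = ∣ π at suc p ∣ ≡ suc (j + p)

record Fixes j (π : Vec ℤ r) : Set where
  constructor mkFixes
  field fixed : ∀ {p} → p < r → FixedAt j π p

record Closes (i m : ℕ) (s : Sign) (j : ℕ) (π : Vec ℤ r) : Set where
  field
    m<r    : m < r
    closed : π at suc m ≡ s ◃ suc i
    fixed  : ∀ {p} → p < r → p ≢ m → FixedAt j π p

-- A single sign serves both letters: if π(a) = sb, then π² = id and oddness force π(b) = sa.
record Swaps (j : ℕ) (π : Vec ℤ r) : Set where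
  field
    {a b} : ℕ
    s     : Sign
    a<b   : a < b
    b<r   : b < r
    at-a  : π at suc a ≡ s ◃ suc (j + b)
    at-b  : π at suc b ≡ s ◃ suc (j + a)
    fixed : ∀ {p} → p < r → p ≢ a → p ≢ b → FixedAt j π p

fixedAt-zero⁺ : ∀ {j} x (π : Vec ℤ r) → ∣ x ∣ ≡ suc j → FixedAt j (x ∷ π) 0
fixedAt-zero⁺ {j = j} x π e = trans e (cong suc (sym (ℕ.+-identityʳ j)))

fixedAt-zero⁻ : ∀ {j} x (π : Vec ℤ r) → FixedAt j (x ∷ π) 0 → ∣ x ∣ ≡ suc j
fixedAt-zero⁻ {j = j} x π e = trans e (cong suc (ℕ.+-identityʳ j))

fixedAt-suc⁺ : ∀ {j p} x (π : Vec ℤ r) → FixedAt (suc j) π p → FixedAt j (x ∷ π) (suc p)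
fixedAt-suc⁺ {j = j} {p} x π e = trans e (cong suc (sym (ℕ.+-suc j p)))

fixedAt-suc⁻ : ∀ {j p} x (π : Vec ℤ r) → FixedAt j (x ∷ π) (suc p) → FixedAt (suc j) π p
fixedAt-suc⁻ {j = j} {p} x π e = trans e (cong suc (ℕ.+-suc j p))

∈-fixing⁻ : ∀ j (π : Vec ℤ r) → π ∈ fixing j r → Fixes j π
∈-fixing⁻ j []      _  = mkFixes λ ()
∈-fixing⁻ j (x ∷ π) π∈ with ∣x∣ , π′∈ ← ∈-extend-signs⁻ π∈ = mkFixes λ
  { {zero}  _         → fixedAt-zero⁺ x π ∣x∣
  ; {suc p} (s≤s p<r) → fixedAt-suc⁺ x π (Fixes.fixed (∈-fixing⁻ (suc j) π π′∈) p<r)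
  }

∈-fixing⁺ : ∀ j (π : Vec ℤ r) → Fixes j π → π ∈ fixing j r
∈-fixing⁺ j []      _   = here refl
∈-fixing⁺ j (x ∷ π) fix = ∈-extend-signs⁺ (fixedAt-zero⁻ x π (fixed z<s))
  (∈-fixing⁺ (suc j) π (mkFixes λ p<r → fixedAt-suc⁻ x π (fixed (s≤s p<r))))
  where open Fixes fix

∈-closing⁻ : ∀ i m s j (π : Vec ℤ r) → π ∈ closing i m s j r → Closes i m s j π
∈-closing⁻ i zero s j (x ∷ π) π∈ with _ , π′∈ , refl ← ∈-map⁻ _ π∈ = record
  { m<r    = z<s
  ; closed = refl
  ; fixed  = λ
      { {zero}  _         0≢0 → contradiction refl 0≢0
      ; {suc p} (s≤s p<r) _   → fixedAt-suc⁺ x π (Fixes.fixed (∈-fixing⁻ (suc j) π π′∈) p<r)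
      }
  }
∈-closing⁻ i (suc m) s j (x ∷ π) π∈ with ∣x∣ , π′∈ ← ∈-extend-signs⁻ π∈ = record
  { m<r    = s≤s m<r
  ; closed = closed
  ; fixed  = λ
      { {zero}  _         _   → fixedAt-zero⁺ x π ∣x∣
      ; {suc p} (s≤s p<r) p≢m → fixedAt-suc⁺ x π (fixed p<r (p≢m ∘ cong suc))
      }
  }
  where open Closes (∈-closing⁻ i m s (suc j) π π′∈)

∈-closing⁺ : ∀ i m s j (π : Vec ℤ r) → Closes i m s j π → π ∈ closing i m s j r
∈-closing⁺ i m s j [] c with () ← Closes.m<r c
∈-closing⁺ i zero s j (x ∷ π) c with refl ← Closes.closed c = ∈-map⁺ _
  (∈-fixing⁺ (suc j) π (mkFixes λ p<r → fixedAt-suc⁻ x π (Closes.fixed c (s≤s p<r) λ ())))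
∈-closing⁺ i (suc m) s j (x ∷ π) c = ∈-extend-signs⁺ (fixedAt-zero⁻ x π (fixed z<s λ ()))
  (∈-closing⁺ i m s (suc j) π record
    { m<r    = ℕ.≤-pred m<r
    ; closed = closed
    ; fixed  = λ p<r p≢m → fixedAt-suc⁻ x π (fixed (s≤s p<r) (p≢m ∘ ℕ.suc-injective))
    })
  where open Closes c

∈-swapping⁻ : ∀ j (π : Vec ℤ r) → π ∈ swapping j r → Swaps j π
∈-swapping⁻ {suc r} j (x ∷ π) π∈
  with ∈-extend⁻ (swappingHead j) (swappingTails j r) (cartesianProduct (upTo (suc r)) signs) π∈
-- The two-cycle lies in the tail, and both of its positions move up by one.
... | (zero , s) , _ , refl , π′∈ = record
  { s     = Swaps.s swaps
  ; a<b   = s≤s a<b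
  ; b<r   = s≤s b<r
  ; at-a  = trans at-a (cong (λ k → Swaps.s swaps ◃ suc k) (sym (ℕ.+-suc j b)))
  ; at-b  = trans at-b (cong (λ k → Swaps.s swaps ◃ suc k) (sym (ℕ.+-suc j a)))
  ; fixed = λ
      { {zero}  _         _   _   → ℤ.abs-◃ s (suc (j + 0))
      ; {suc p} (s≤s p<r) p≢a p≢b → fixedAt-suc⁺ x π (fixed p<r (p≢a ∘ cong suc) (p≢b ∘ cong suc))
      }
  }
  where
  swaps = ∈-swapping⁻ (suc j) π π′∈
  open Swaps swaps hiding (s)
-- The first letter opens the two-cycle, so a = 0 and b = m + 1.
... | (suc m , s) , _ , refl , π′∈ = record
  { s     = s
  ; a<b   = z<s
  ; b<r   = s≤s m<r
  ; at-a  = refl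
  ; at-b  = trans closed (cong (λ k → s ◃ suc k) (sym (ℕ.+-identityʳ j)))
  ; fixed = λ
      { {zero}  _         0≢0 _   → contradiction refl 0≢0
      ; {suc p} (s≤s p<r) _   p≢m → fixedAt-suc⁺ x π (fixed p<r (p≢m ∘ cong suc))
      }
  }
  where open Closes (∈-closing⁻ j m s (suc j) π π′∈)

∈-swapping⁺ : ∀ j (π : Vec ℤ r) → Swaps j π → π ∈ swapping j r
∈-swapping⁺ j [] record { b<r = () }
∈-swapping⁺ {suc r} j (x ∷ π) record { a = zero ; b = suc b ; s = s ; b<r = s≤s b<r ; at-a = refl ; at-b = at-b ; fixed = fixed } =
  ∈-extend⁺ (swappingHead j) (swappingTails j r)
    (∈-cartesianProduct⁺ (∈-upTo⁺ (s≤s b<r)) (∈-signs s))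
    (∈-closing⁺ j b s (suc j) π record
      { m<r    = b<r
      ; closed = trans at-b (cong (λ k → s ◃ suc k) (ℕ.+-identityʳ j))
      ; fixed  = λ p<r p≢b → fixedAt-suc⁻ x π (fixed (s≤s p<r) (λ ()) (p≢b ∘ ℕ.suc-injective))
      })
∈-swapping⁺ {suc r} j (x ∷ π) record { a = suc a ; b = suc b ; s = s ; a<b = s≤s a<b ; b<r = s≤s b<r ; at-a = at-a ; at-b = at-b ; fixed = fixed } =
  subst (λ y → (y ∷ π) ∈ swapping j (suc r)) (sym (abs≡⇒◃ x (fixed z<s (λ ()) (λ ()))))
    (∈-extend⁺ (swappingHead j) (swappingTails j r)
      (∈-cartesianProduct⁺ (∈-upTo⁺ {suc r} z<s) (∈-signs (sign x)))
      (∈-swapping⁺ (suc j) π record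
        { s     = s
        ; a<b   = a<b
        ; b<r   = b<r
        ; at-a  = trans at-a (cong (λ k → s ◃ suc k) (ℕ.+-suc j b))
        ; at-b  = trans at-b (cong (λ k → s ◃ suc k) (ℕ.+-suc j a))
        ; fixed = λ p<r p≢a p≢b → fixedAt-suc⁻ x π
            (fixed (s≤s p<r) (p≢a ∘ ℕ.suc-injective) (p≢b ∘ ℕ.suc-injective))
        }))

-- The index set of F_{1,f}

unique-↭ : ∀ {A : Set} {xs ys : List A} → Unique xs → Unique ys →
  (∀ {x} → x ∈ xs → x ∈ ys) → (∀ {x} → x ∈ ys → x ∈ xs) → xs ↭ ys
unique-↭ uxs uys f g = ∼bag⇒↭ (unique∧set⇒bag uxs uys (mk⇔ f g))

∈[1⋯]⁺ : ∀ {p} → p < n → suc p ∈ [1⋯ n ]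
∈[1⋯]⁺ p<n = ∈-map⁺ suc (∈-upTo⁺ p<n)

∈[1⋯]⁻ : ∀ {i} → i ∈ [1⋯ n ] → ∃[ p ] p < n × i ≡ suc p
∈[1⋯]⁻ i∈ with p , p∈ , refl ← ∈-map⁻ suc i∈ = p , ∈-upTo⁻ p∈ , refl

[1⋯]-unique : ∀ n → Unique [1⋯ n ]
[1⋯]-unique n = Unique.map⁺ ℕ.suc-injective (Unique.upTo⁺ n)

toList≡map-at : (π : Vec ℤ n) → toList π ≡ map (π at_) [1⋯ n ]
toList≡map-at {n} π = trans (go π) (trans (sym (map-upTo _ n)) (map-∘ (upTo n)))
  where
  go : ∀ {n} (π : Vec ℤ n) → toList π ≡ applyUpTo (λ p → π at suc p) n
  go []      = refl
  go (x ∷ π) = cong (x ∷_) (go π)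

-- By oddness the sign `s` occurs twice and cancels.
⟨⟩-◃⁺ : ∀ (π : Vec ℤ n) s {k l} → π at suc k ≡ s ◃ suc l → π ⟨ s ◃ suc k ⟩ ≡ + suc l
⟨⟩-◃⁺ π Sign.+ e = e
⟨⟩-◃⁺ π Sign.- e = cong ℤ.-_ e

⟨⟩-◃⁻ : ∀ (π : Vec ℤ n) s {k l} → π ⟨ s ◃ suc k ⟩ ≡ + suc l → π at suc k ≡ s ◃ suc l
⟨⟩-◃⁻ π Sign.+ e = e
⟨⟩-◃⁻ π Sign.- e = ℤ.neg-injective e

⟨-⟩ : ∀ (π : Vec ℤ n) x → π ⟨ ℤ.- x ⟩ ≡ ℤ.- π ⟨ x ⟩
⟨-⟩ π (+ zero)   = refl
⟨-⟩ π (+ suc k)  = refl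
⟨-⟩ π -[1+ k ]   = sym (ℤ.neg-involutive _)

-- The case k = l covers the letters fixed up to sign.
exchange⇒involutiveAt : ∀ (π : Vec ℤ n) s {k l} → π at suc k ≡ s ◃ suc l → π at suc l ≡ s ◃ suc k →
  π ⟨ π ⟨ + suc k ⟩ ⟩ ≡ + suc k × π ⟨ π ⟨ ℤ.- + suc k ⟩ ⟩ ≡ ℤ.- + suc k
exchange⇒involutiveAt π s {k} ek el = π²k , trans (⟨-⟩ π (π at suc k)) (cong ℤ.-_ π²k)
  where
  π²k : π ⟨ π at suc k ⟩ ≡ + suc k
  π²k = trans (cong (π ⟨_⟩) ek) (⟨⟩-◃⁺ π s el)

-- From one swap to the class

TwoCycle : Vec ℤ n → ℕ × ℕ → Set
TwoCycle π (i , k) = i < k × ∣ π at i ∣ ≡ k × ∣ π at k ∣ ≡ i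

twoCycle? : (π : Vec ℤ n) → Decidable (TwoCycle π)
twoCycle? π (i , k) = (i ℕ.<? k) ×-dec (∣ π at i ∣ ℕ.≟ k) ×-dec (∣ π at k ∣ ℕ.≟ i)

swaps⇒inClass : ∀ f (π : Vec ℤ (2 + f)) → Swaps 0 π → InClass 1 f π
swaps⇒inClass f π swaps = signedPermutation , involutive , oneCycle , fixCount
  where
  open Swaps swaps

  fix? = λ i → ∣ π at i ∣ ℕ.≟ i
  fixedPoints = filter fix? [1⋯ 2 + f ]

  ∣π⟨a⟩∣ : ∣ π at suc a ∣ ≡ suc b
  ∣π⟨a⟩∣ = trans (cong ∣_∣ at-a) (ℤ.abs-◃ s (suc b))

  ∣π⟨b⟩∣ : ∣ π at suc b ∣ ≡ suc a
  ∣π⟨b⟩∣ = trans (cong ∣_∣ at-b) (ℤ.abs-◃ s (suc a))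

  a<r = ℕ.<-trans a<b b<r

  -- This splitting of the positions yields both the permutation property and the number of fixed
  -- points.
  decomposition : [1⋯ 2 + f ] ↭ suc a ∷ suc b ∷ fixedPoints
  decomposition = unique-↭ ([1⋯]-unique _)
    ((ℕ.<⇒≢ (s≤s a<b) ∷ All.tabulate a∉) ∷ All.tabulate b∉ ∷ Unique.filter⁺ fix? ([1⋯]-unique _))
    to from
    where
    a∉ : ∀ {i} → i ∈ fixedPoints → suc a ≢ i
    a∉ i∈ refl = ℕ.>⇒≢ a<b (ℕ.suc-injective (trans (sym ∣π⟨a⟩∣) (proj₂ (∈-filter⁻ fix? {xs = [1⋯ 2 + f ]} i∈))))
    b∉ : ∀ {i} → i ∈ fixedPoints → suc b ≢ i
    b∉ i∈ refl = ℕ.<⇒≢ a<b (ℕ.suc-injective (trans (sym ∣π⟨b⟩∣) (proj₂ (∈-filter⁻ fix? {xs = [1⋯ 2 + f ]} i∈))))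
    to : ∀ {i} → i ∈ [1⋯ 2 + f ] → i ∈ suc a ∷ suc b ∷ fixedPoints
    to i∈ with p , p<r , refl ← ∈[1⋯]⁻ {2 + f} i∈ with p ℕ.≟ a | p ℕ.≟ b
    ... | yes refl | _        = here refl
    ... | no _     | yes refl = there (here refl)
    ... | no p≢a   | no p≢b   = there (there (∈-filter⁺ fix? i∈ (fixed p<r p≢a p≢b)))
    from : ∀ {i} → i ∈ suc a ∷ suc b ∷ fixedPoints → i ∈ [1⋯ 2 + f ]
    from (here refl)         = ∈[1⋯]⁺ a<r
    from (there (here refl)) = ∈[1⋯]⁺ b<r
    from (there (there i∈))  = proj₁ (∈-filter⁻ fix? i∈)

  signedPermutation : SignedPermutation π
  signedPermutation = begin
    map ∣_∣ (toList π)                                ≡⟨ cong (map ∣_∣) (toList≡map-at π) ⟩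
    map ∣_∣ (map (π at_) [1⋯ 2 + f ])                 ≡⟨ map-∘ [1⋯ 2 + f ] ⟨
    map (λ i → ∣ π at i ∣) [1⋯ 2 + f ]                ↭⟨ ↭.map⁺ _ decomposition ⟩
    ∣ π at suc a ∣ ∷ ∣ π at suc b ∣ ∷ map _ fixedPoints ≡⟨ cong₂ _∷_ ∣π⟨a⟩∣ (cong₂ _∷_ ∣π⟨b⟩∣ (map-id-local (All.tabulate λ i∈ → proj₂ (∈-filter⁻ fix? {xs = [1⋯ 2 + f ]} i∈)))) ⟩
    suc b ∷ suc a ∷ fixedPoints                       ↭⟨ swap _ _ ↭-refl ⟩
    suc a ∷ suc b ∷ fixedPoints                       ↭⟨ decomposition ⟨
    [1⋯ 2 + f ]                                       ∎
    where open ↭.PermutationReasoning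

  fixCount : fixᴮ π ≡ f
  -- Comparing lengths in `decomposition` gives 2 + `fixᴮ π` = 2 + f.
  fixCount = ℕ.suc-injective (ℕ.suc-injective (begin
    length (suc a ∷ suc b ∷ fixedPoints) ≡⟨ ↭.↭-length decomposition ⟨
    length [1⋯ 2 + f ]                   ≡⟨ length-map suc (upTo (2 + f)) ⟩
    length (upTo (2 + f))                ≡⟨ length-upTo (2 + f) ⟩
    2 + f                                ∎))
    where open ≡-Reasoning

  involutive : Involutive π
  involutive = All.tabulate λ i∈ → go (∈[1⋯]⁻ {2 + f} i∈)
    where
    go : ∀ {i} → ∃[ p ] p < 2 + f × i ≡ suc p → π ⟨ π ⟨ + i ⟩ ⟩ ≡ + i × π ⟨ π ⟨ ℤ.- + i ⟩ ⟩ ≡ ℤ.- + i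
    go (p , p<r , refl) with p ℕ.≟ a | p ℕ.≟ b
    ... | yes refl | _        = exchange⇒involutiveAt π s at-a at-b
    ... | no _     | yes refl = exchange⇒involutiveAt π s at-b at-a
    ... | no p≢a   | no p≢b   = exchange⇒involutiveAt π (sign (π at suc p)) e e
      where e = abs≡⇒◃ (π at suc p) (fixed p<r p≢a p≢b)

  oneCycle : cyc₂ π ≡ 1
  oneCycle = ↭.↭-length (unique-↭ {ys = [ (suc a , suc b) ]}
    (Unique.filter⁺ (twoCycle? π) (Unique.cartesianProduct⁺ ([1⋯]-unique (2 + f)) ([1⋯]-unique (2 + f))))
    ([] ∷ [])
    (λ c∈ → let c∈² , cycle = ∈-filter⁻ (twoCycle? π) {xs = cartesianProduct [1⋯ 2 + f ] [1⋯ 2 + f ]} c∈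
                i∈ , _ = ∈-cartesianProduct⁻ [1⋯ 2 + f ] [1⋯ 2 + f ] c∈²
            in here (only (∈[1⋯]⁻ {2 + f} i∈) cycle))
    λ { (here refl) → ∈-filter⁺ (twoCycle? π) (∈-cartesianProduct⁺ (∈[1⋯]⁺ a<r) (∈[1⋯]⁺ b<r)) (s≤s a<b , ∣π⟨a⟩∣ , ∣π⟨b⟩∣) })
    where
    only : ∀ {i k} → ∃[ p ] p < 2 + f × i ≡ suc p → TwoCycle π (i , k) → (i , k) ≡ (suc a , suc b)
    only (p , p<r , refl) (i<k , ei , ek) with p ℕ.≟ a | p ℕ.≟ b
    ... | yes refl | _        = cong (suc p ,_) (trans (sym ei) ∣π⟨a⟩∣)
    -- Starting at b, the cycle would lead to a < b, against the order i < k.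
    ... | no _     | yes refl =
      contradiction (ℕ.<-trans i<k (s≤s (subst (_≤ b) (trans (sym ∣π⟨b⟩∣) ei) a<b))) (ℕ.<-irrefl refl)
    ... | no p≢a   | no p≢b   = contradiction (trans (sym (fixed p<r p≢a p≢b)) ei) (ℕ.<⇒≢ i<k)

-- From the class to one swap

length≡1⇒singleton : ∀ {A : Set} (xs : List A) → length xs ≡ 1 →
  ∃[ x ] x ∈ xs × (∀ {y} → y ∈ xs → y ≡ x)
length≡1⇒singleton (x ∷ []) refl = x , here refl , λ { (here eq) → eq }

abs-at-∈ : ∀ (π : Vec ℤ n) → SignedPermutation π → ∀ {p} → p < n →
  ∃[ q ] q < n × ∣ π at suc p ∣ ≡ suc q
abs-at-∈ {n} π perm {p} p<n = ∈[1⋯]⁻ {n} (↭.∈-resp-↭ perm (∈-map⁺ ∣_∣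
  (subst (π at suc p ∈_) (sym (toList≡map-at π)) (∈-map⁺ (π at_) (∈[1⋯]⁺ p<n)))))

-- With s the sign of the letter at p+1, π² = id gives π(s(q+1)) = p+1, and oddness moves s to the
-- other side. This is the source of the common sign in `Swaps`.
involutive⇒back : ∀ (π : Vec ℤ n) → Involutive π → ∀ {p q} → p < n → ∣ π at suc p ∣ ≡ suc q →
  π at suc q ≡ sign (π at suc p) ◃ suc p
involutive⇒back π inv {p} p<n e = ⟨⟩-◃⁻ π (sign (π at suc p))
  (trans (cong (π ⟨_⟩) (sym (abs≡⇒◃ (π at suc p) e))) (proj₁ (All.lookup inv (∈[1⋯]⁺ p<n))))

inClass⇒swaps : ∀ f (π : Vec ℤ n) → InClass 1 f π → Swaps 0 π
inClass⇒swaps {n} f π (perm , inv , oneCycle , _)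
  with c , c∈ , only ← length≡1⇒singleton (filter (twoCycle? π) (cartesianProduct [1⋯ n ] [1⋯ n ])) oneCycle
  with c∈² , cycle ← ∈-filter⁻ (twoCycle? π) {xs = cartesianProduct [1⋯ n ] [1⋯ n ]} c∈
  with i∈ , k∈ ← ∈-cartesianProduct⁻ [1⋯ n ] [1⋯ n ] c∈²
  with a , a<n , refl ← ∈[1⋯]⁻ {n} i∈ | b , b<n , refl ← ∈[1⋯]⁻ {n} k∈
  with s≤s a<b , ∣π⟨a⟩∣ , _ ← cycle = record
  { s     = sign (π at suc a)
  ; a<b   = a<b
  ; b<r   = b<n
  ; at-a  = abs≡⇒◃ (π at suc a) ∣π⟨a⟩∣
  ; at-b  = involutive⇒back π inv a<n ∣π⟨a⟩∣
  ; fixed = fixed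
  }
  where
  ∈-cycles : ∀ {p q} → p < n → q < n → TwoCycle π (suc p , suc q) → _
  ∈-cycles p<n q<n cycle =
    only (∈-filter⁺ (twoCycle? π) (∈-cartesianProduct⁺ (∈[1⋯]⁺ p<n) (∈[1⋯]⁺ q<n)) cycle)

  fixed : ∀ {p} → p < n → p ≢ a → p ≢ b → FixedAt 0 π p
  fixed {p} p<n p≢a p≢b with q , q<n , eq ← abs-at-∈ π perm p<n
                        with back ← trans (cong ∣_∣ (involutive⇒back π inv p<n eq)) (ℤ.abs-◃ (sign (π at suc p)) _)
                        -- If q ≠ p, then p and q in increasing order form a two-cycle, hence the
                        -- only one, so p is a or b.
                        with ℕ.<-cmp p q
  ... | tri< p<q _ _  = contradiction (ℕ.suc-injective (cong proj₁ (∈-cycles p<n q<n (s≤s p<q , eq , back)))) p≢a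
  ... | tri≈ _ refl _ = eq
  ... | tri> _ _ q<p  = contradiction (ℕ.suc-injective (cong proj₂ (∈-cycles q<n p<n (s≤s q<p , back , eq)))) p≢b

class↭swapping : ∀ f → class (2 + f) 1 f ↭ swapping 0 (2 + f)
class↭swapping f = unique-↭ (class-unique (2 + f) 1 f) (swapping-unique 0 (2 + f))
  (λ {π} π∈ → ∈-swapping⁺ 0 π (inClass⇒swaps f π (Equivalence.to (∈-class 1 f π) π∈)))
  (λ {π} π∈ → Equivalence.from (∈-class 1 f π) (swaps⇒inClass f π (∈-swapping⁻ 0 π π∈)))

-- The semiring of polynomials

coeff-⊕ : ∀ p q k → coeff (p ⊕ q) k ≡ coeff p k + coeff q k
coeff-⊕ []      q       k       = refl
coeff-⊕ (a ∷ p) []      k       = sym (ℕ.+-identityʳ _)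
coeff-⊕ (a ∷ p) (b ∷ q) zero    = refl
coeff-⊕ (a ∷ p) (b ∷ q) (suc k) = coeff-⊕ p q k

coeff-scale : ∀ a p k → coeff (map (a *_) p) k ≡ a * coeff p k
coeff-scale a []      k       = sym (ℕ.*-zeroʳ a)
coeff-scale a (b ∷ p) zero    = refl
coeff-scale a (b ∷ p) (suc k) = coeff-scale a p k

≈-isEquivalence : IsEquivalence _≈_
≈-isEquivalence = record
  { refl  = λ k → refl
  ; sym   = λ e k → sym (e k)
  ; trans = λ e e′ k → trans (e k) (e′ k)
  }

⊕-cong : ∀ {p p′ q q′} → p ≈ p′ → q ≈ q′ → p ⊕ q ≈ p′ ⊕ q′
⊕-cong {p} {p′} {q} {q′} e e′ k
  rewrite coeff-⊕ p q k | coeff-⊕ p′ q′ k | e k | e′ k = refl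

⊕-assoc : ∀ p q r → (p ⊕ q) ⊕ r ≈ p ⊕ (q ⊕ r)
⊕-assoc p q r k
  rewrite coeff-⊕ (p ⊕ q) r k | coeff-⊕ p q k | coeff-⊕ p (q ⊕ r) k | coeff-⊕ q r k
  = ℕ.+-assoc (coeff p k) _ _

⊕-comm : ∀ p q → p ⊕ q ≈ q ⊕ p
⊕-comm p q k rewrite coeff-⊕ p q k | coeff-⊕ q p k = ℕ.+-comm (coeff p k) _

coeff-⊗-zero : ∀ a p q → coeff ((a ∷ p) ⊗ q) 0 ≡ a * coeff q 0
coeff-⊗-zero a p q
  rewrite coeff-⊕ (map (a *_) q) (0 ∷ (p ⊗ q)) 0 | coeff-scale a q 0 = ℕ.+-identityʳ _

coeff-⊗-suc : ∀ a p q k → coeff ((a ∷ p) ⊗ q) (suc k) ≡ a * coeff q (suc k) + coeff (p ⊗ q) k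
coeff-⊗-suc a p q k
  rewrite coeff-⊕ (map (a *_) q) (0 ∷ (p ⊗ q)) (suc k) | coeff-scale a q (suc k) = refl

⊗-zeroʳ : ∀ p → p ⊗ [] ≈ []
⊗-zeroʳ []      k       = refl
⊗-zeroʳ (a ∷ p) zero    = refl
⊗-zeroʳ (a ∷ p) (suc k) = ⊗-zeroʳ p k

⊗-congʳ : ∀ p {q q′} → q ≈ q′ → p ⊗ q ≈ p ⊗ q′
⊗-congʳ []      e k = refl
⊗-congʳ (a ∷ p) {q} {q′} e zero
  rewrite coeff-⊗-zero a p q | coeff-⊗-zero a p q′ = cong (a *_) (e 0)
⊗-congʳ (a ∷ p) {q} {q′} e (suc k)
  rewrite coeff-⊗-suc a p q k | coeff-⊗-suc a p q′ k
  = cong₂ (λ x y → a * x + y) (e (suc k)) (⊗-congʳ p e k)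

-- The definition of `_⊗_` unfolds the left factor; `⊗-comm` compares it with this unfolding of the
-- right one.
coeff-⊗-∷ : ∀ p b q k → coeff (p ⊗ (b ∷ q)) (suc k) ≡ coeff p (suc k) * b + coeff (p ⊗ q) k
coeff-⊗-∷ [] b q k = refl
-- A one-term factor leaves a padding `0 ∷ []` in the product; `help` checks that it adds nothing.
coeff-⊗-∷ (a ∷ []) b q k
  rewrite coeff-⊗-suc a [] (b ∷ q) k | coeff-⊕ (map (a *_) q) (0 ∷ []) k | coeff-scale a q k = help k
  where
  help : ∀ k → a * coeff q k + 0 ≡ a * coeff q k + coeff (0 ∷ []) k
  help zero    = refl
  help (suc k) = refl
coeff-⊗-∷ (a ∷ a′ ∷ p) b q zero
  rewrite coeff-⊗-suc a (a′ ∷ p) (b ∷ q) 0 | coeff-⊗-zero a′ p (b ∷ q) | coeff-⊗-zero a (a′ ∷ p) q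
  = ℕ.+-comm (a * coeff q 0) _
coeff-⊗-∷ (a ∷ a′ ∷ p) b q (suc k)
  rewrite coeff-⊗-suc a (a′ ∷ p) (b ∷ q) (suc k) | coeff-⊗-suc a (a′ ∷ p) q k
        | coeff-⊗-∷ (a′ ∷ p) b q k
  = solve 3 (λ x y z → x :+ (y :+ z) := y :+ (x :+ z)) refl
      (a * coeff q (suc k)) (coeff p k * b) (coeff ((a′ ∷ p) ⊗ q) k)
  where open +-*-Solver

⊗-comm : ∀ p q → p ⊗ q ≈ q ⊗ p
⊗-comm []      q k = sym (⊗-zeroʳ q k)
⊗-comm (a ∷ p) []      k    = ⊗-zeroʳ (a ∷ p) k
⊗-comm (a ∷ p) (b ∷ q) zero
  rewrite coeff-⊗-zero a p (b ∷ q) | coeff-⊗-zero b q (a ∷ p) = ℕ.*-comm a b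
⊗-comm (a ∷ p) (b ∷ q) (suc k)
  rewrite coeff-⊗-suc a p (b ∷ q) k | coeff-⊗-∷ (b ∷ q) a p k
  = cong₂ _+_ (ℕ.*-comm a (coeff q k)) (⊗-comm p (b ∷ q) k)

-- `p` and `p′` may differ in length by trailing zeros, so a change of the left factor is moved to
-- the right by commutativity.
⊗-cong : ∀ {p p′ q q′} → p ≈ p′ → q ≈ q′ → p ⊗ q ≈ p′ ⊗ q′
⊗-cong {p} {p′} {q} {q′} e e′ k = begin
  coeff (p ⊗ q) k   ≡⟨ ⊗-congʳ p e′ k ⟩
  coeff (p ⊗ q′) k  ≡⟨ ⊗-comm p q′ k ⟩
  coeff (q′ ⊗ p) k  ≡⟨ ⊗-congʳ q′ e k ⟩
  coeff (q′ ⊗ p′) k ≡⟨ ⊗-comm q′ p′ k ⟩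
  coeff (p′ ⊗ q′) k ∎
  where open ≡-Reasoning

⊗-distribʳ-⊕ : ∀ r p q → (p ⊕ q) ⊗ r ≈ p ⊗ r ⊕ q ⊗ r
⊗-distribʳ-⊕ r []      q       k = refl
⊗-distribʳ-⊕ r (a ∷ p) []      k
  rewrite coeff-⊕ ((a ∷ p) ⊗ r) [] k = sym (ℕ.+-identityʳ _)
⊗-distribʳ-⊕ r (a ∷ p) (b ∷ q) zero
  rewrite coeff-⊕ ((a ∷ p) ⊗ r) ((b ∷ q) ⊗ r) 0
        | coeff-⊗-zero (a + b) (p ⊕ q) r | coeff-⊗-zero a p r | coeff-⊗-zero b q r
  = ℕ.*-distribʳ-+ (coeff r 0) a b
⊗-distribʳ-⊕ r (a ∷ p) (b ∷ q) (suc k)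
  rewrite coeff-⊕ ((a ∷ p) ⊗ r) ((b ∷ q) ⊗ r) (suc k)
        | coeff-⊗-suc (a + b) (p ⊕ q) r k | coeff-⊗-suc a p r k | coeff-⊗-suc b q r k
        | ⊗-distribʳ-⊕ r p q k | coeff-⊕ (p ⊗ r) (q ⊗ r) k
  = solve 5 (λ x y z u v → (x :+ y) :* z :+ (u :+ v) := x :* z :+ u :+ (y :* z :+ v)) refl
      a b (coeff r (suc k)) (coeff (p ⊗ r) k) (coeff (q ⊗ r) k)
  where open +-*-Solver

scale-⊗ : ∀ a p q → map (a *_) p ⊗ q ≈ map (a *_) (p ⊗ q)
scale-⊗ a []      q k = refl
scale-⊗ a (b ∷ p) q zero
  rewrite coeff-scale a ((b ∷ p) ⊗ q) 0
        | coeff-⊗-zero (a * b) (map (a *_) p) q | coeff-⊗-zero b p q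
  = ℕ.*-assoc a b _
scale-⊗ a (b ∷ p) q (suc k)
  rewrite coeff-scale a ((b ∷ p) ⊗ q) (suc k)
        | coeff-⊗-suc (a * b) (map (a *_) p) q k | coeff-⊗-suc b p q k
        | scale-⊗ a p q k | coeff-scale a (p ⊗ q) k
  = solve 4 (λ x y z u → x :* y :* z :+ x :* u := x :* (y :* z :+ u)) refl
      a b (coeff q (suc k)) (coeff (p ⊗ q) k)
  where open +-*-Solver

-- Induction on `p`: distributivity splits off the constant coefficient, handled by `scale-⊗`, and
-- the rest is the induction hypothesis shifted by one degree.
⊗-assoc : ∀ p q r → (p ⊗ q) ⊗ r ≈ p ⊗ (q ⊗ r)
⊗-assoc []      q r k = refl
⊗-assoc (a ∷ p) q r k
  rewrite ⊗-distribʳ-⊕ r (map (a *_) q) (0 ∷ (p ⊗ q)) k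
        | coeff-⊕ (map (a *_) q ⊗ r) ((0 ∷ (p ⊗ q)) ⊗ r) k
        | coeff-⊕ (map (a *_) (q ⊗ r)) (0 ∷ (p ⊗ (q ⊗ r))) k
        | scale-⊗ a q r k
  = cong (λ c → coeff (map (a *_) (q ⊗ r)) k + c) (shifted k)
  where
  shifted : ∀ k → coeff ((0 ∷ (p ⊗ q)) ⊗ r) k ≡ coeff (0 ∷ (p ⊗ (q ⊗ r))) k
  shifted zero    = coeff-⊗-zero 0 (p ⊗ q) r
  shifted (suc k) = trans (coeff-⊗-suc 0 (p ⊗ q) r k) (⊗-assoc p q r k)

⊗-identityˡ : ∀ p → const 1 ⊗ p ≈ p
⊗-identityˡ p zero    = trans (coeff-⊗-zero 1 [] p) (ℕ.*-identityˡ _)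
⊗-identityˡ p (suc k) =
  trans (coeff-⊗-suc 1 [] p k) (trans (ℕ.+-identityʳ _) (ℕ.*-identityˡ _))

⊕-⊗-commutativeSemiring : CommutativeSemiring 0ℓ 0ℓ
⊕-⊗-commutativeSemiring = record
  { Carrier = Poly
  ; _≈_ = _≈_
  ; _+_ = _⊕_
  ; _*_ = _⊗_
  ; 0#  = []
  ; 1#  = const 1
  ; isCommutativeSemiring = Biased.isCommutativeSemiringˡ record
    { +-isCommutativeMonoid = Biased.isCommutativeMonoidˡ record
      { isSemigroup = record
        { isMagma = record { isEquivalence = ≈-isEquivalence
                           ; ∙-cong = λ {p} {p′} {q} {q′} → ⊕-cong {p} {p′} {q} {q′} }
        ; assoc = ⊕-assoc }
      ; identityˡ = λ p k → refl
      ; comm = ⊕-comm }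
    ; *-isCommutativeMonoid = Biased.isCommutativeMonoidˡ record
      { isSemigroup = record
        { isMagma = record { isEquivalence = ≈-isEquivalence
                           ; ∙-cong = λ {p} {p′} {q} {q′} → ⊗-cong {p} {p′} {q} {q′} }
        ; assoc = ⊗-assoc }
      ; identityˡ = ⊗-identityˡ
      ; comm = ⊗-comm }
    ; distribʳ = ⊗-distribʳ-⊕
    ; zeroˡ = λ p k → refl
    }
  }

-- Specialization to polynomials in t

open CommutativeSemiring ⊕-⊗-commutativeSemiring using (semiring; setoid; reflexive)
open import Algebra.Properties.Semiring.Exp semiring using (_^_)
open import Algebra.Properties.Semiring.Mult semiring using () renaming (_×_ to _·_)
open GeneratingFunction ⊕-⊗-commutativeSemiring t

^≡↑ : ∀ p k → p ^ k ≡ p ↑ k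
^≡↑ p zero    = ≡.refl
^≡↑ p (suc k) = ≡.cong (p ⊗_) (^≡↑ p k)

·-const : ∀ n → n · const 1 ≈ const n
-- The lists are `[]` and `0 ∷ []`, which agree only coefficientwise.
·-const zero    zero    = ≡.refl
·-const zero    (suc k) = ≡.refl
·-const (suc n) k       =
  ≡.trans (coeff-⊕ (const 1) (n · const 1) k) (≡.trans (≡.cong (λ c → coeff (const 1) k + c) (·-const n k)) (unit-+ k))
  where
  unit-+ : ∀ k → coeff (const 1) k + coeff (const n) k ≡ coeff (const (suc n)) k
  unit-+ zero    = ≡.refl
  unit-+ (suc k) = ≡.refl

·-⊗-^ : ∀ n p q k → (n · const 1) ⊗ p ⊗ q ^ k ≈ const n ⊗ p ⊗ q ↑ k
·-⊗-^ n p q k rewrite ^≡↑ q k =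
  ⊗-cong {(n · const 1) ⊗ p} {const n ⊗ p} {q ↑ k} {q ↑ k}
    (⊗-cong {n · const 1} {const n} {p} {p} (·-const n) (λ _ → ≡.refl)) (λ _ → ≡.refl)

corollary6p4 : (f : ℕ) →
    F 1 f ≈ const (2 * (2 * f + 1)) ⊗ t ⊗ (const 1 ⊕ t) ↑ f
    ⊕ const (8 * (f C 2)) ⊗ t ↑ 2 ⊗ (const 1 ⊕ t) ↑ (f ∸ 2)
corollary6p4 f = begin
  F 1 f
    ≈⟨ Σ-cong (λ π → reflexive (≡.sym (^≡↑ t (desᴮ π)))) (class (2 + f) 1 f) ⟩
  Σ⟨ (λ π → t ^ desᴮ π) ⟩ (class (2 + f) 1 f)
    ≈⟨ Σ-↭ (λ π → t ^ desᴮ π) (class↭swapping f) ⟩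
  Σ⟨ (λ π → t ^ desᴮ π) ⟩ (swapping 0 (2 + f))
    ≈⟨ Σ-desᴮ (swapping 0 (2 + f)) ⟩
  gf (+ 0) (swapping 0 (2 + f))
    -- The letter in front is π_0 = 0, so the bound on its absolute value holds with j = 0.
    ≈⟨ gf-swapping 0 (2 + f) (+ 0) z≤n ⟩
  swapPolynomial f
    ≈⟨ swapPolynomial≋ f ⟩
  ((2 * (2 * f + 1)) · const 1) ⊗ t ⊗ (const 1 ⊕ t) ^ f
    ⊕ ((8 * (f C 2)) · const 1) ⊗ t ↑ 2 ⊗ (const 1 ⊕ t) ^ (f ∸ 2)
    ≈⟨ ⊕-cong {a · const 1 ⊗ t ⊗ (const 1 ⊕ t) ^ f} {const a ⊗ t ⊗ (const 1 ⊕ t) ↑ f}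
              {b · const 1 ⊗ t ↑ 2 ⊗ (const 1 ⊕ t) ^ (f ∸ 2)} {const b ⊗ t ↑ 2 ⊗ (const 1 ⊕ t) ↑ (f ∸ 2)}
         (·-⊗-^ a t (const 1 ⊕ t) f) (·-⊗-^ b (t ↑ 2) (const 1 ⊕ t) (f ∸ 2)) ⟩
  const (2 * (2 * f + 1)) ⊗ t ⊗ (const 1 ⊕ t) ↑ f
    ⊕ const (8 * (f C 2)) ⊗ t ↑ 2 ⊗ (const 1 ⊕ t) ↑ (f ∸ 2) ∎
  where
  a b : ℕ
  a = 2 * (2 * f + 1)
  b = 8 * (f C 2)
  open import Relation.Binary.Reasoning.Setoid setoid
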